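{- Let $\mathcal{P}=(P,\leq)$ be a finite bounded poset which is EL-shellable, with EL-labeling $\lambda:\mathcal{E}(\mathcal{P})\to\Lambda$. Then for every integer $m>0$ the product labeling $\lambda^{m}$ (restricted to the cover relations of $\mathcal{P}^{[m]}$) is an EL-labeling of the poset of $m$-multichains $\mathcal{P}^{[m]}$.
   Context: Poset of multichains: for a finite poset $\mathcal{P}=(P,\leq)$ and an integer $m>0$, let $P^{[m]}=\{(x_1,\ldots,x_m)\in P^m\mid x_1\leq x_2\leq\cdots\leq x_m\}$, and let $\mathcal{P}^{[m]}=(P^{[m]},\leq)$ with the componentwise order. A poset is bounded if it has a unique minimal element $\hat 0$ and a unique maximal element $\hat 1$; if $\mathcal{P}$ is finite and bounded, so is $\mathcal{P}^{[m]}$. Write $x\lessdot y$ if $x<y$ and there is no $z$ with $x<z<y$, and let $\mathcal{E}(\mathcal{P})=\{(x,y)\mid x\lessdot y\}$. Edge-labelings: an edge-labeling of $\mathcal{P}$ is a map $\lambda:\mathcal{E}(\mathcal{P})\to\Lambda$, where $(\Lambda,\leq_\Lambda)$ is an arbitrary poset. A maximal chain $x_1\lessdot x_2\lessdot\cdots\lessdot x_s$ of an interval $[x,y]=\{z\mid x\leq z\leq y\}$ (so $x_1=x$, $x_s=y$) has label sequence $(\lambda(x_1,x_2),\lambda(x_2,x_3),\ldots,\lambda(x_{s-1},x_s))$; the chain is rising if its label sequence is strictly increasing with respect to $\leq_\Lambda$. Finite tuples over $\Lambda$ are compared lexicographically: $(k_1,\ldots,k_s)\leq_{\mathrm{lex}}(l_1,\ldots,l_t)$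 if and only if either $s\leq t$ and $k_i=l_i$ for all $i\leq s$, or $k_i<_\Lambda l_i$ for the least $i$ with $k_i\neq l_i$. One maximal chain precedes another if its label sequence is $\leq_{\mathrm{lex}}$ that of the other. An edge-labeling $\lambda$ of a bounded poset is an EL-labeling if for every interval $[x,y]$ (with $x\leq y$) there exists a unique rising maximal chain in $[x,y]$, and this chain precedes every other maximal chain of $[x,y]$. A bounded poset admitting an EL-labeling is called EL-shellable. Product labeling: adjoin to $\Lambda$ a formal symbol $\delta$ as a new least element. Two elements $\mathbf{x}=(x_1,\ldots,x_m)$ and $\mathbf{y}=(y_1,\ldots,y_m)$ of $P^{[m]}$ with $\mathbf{x}\lessdot\mathbf{y}$ in $\mathcal{P}^{[m]}$ differ in exactly one index $j$, and $x_j\lessdot y_j$ for this index. Define $\lambda^{m}(\mathbf{x},\mathbf{y})=(\delta,\ldots,\delta,\lambda(x_j,y_j),\delta,\ldots,\delta)\in(\Lambda\cup\{\delta\})^m$, with $\lambda(x_j,y_j)$ at position $j$. The label set $(\Lambda\cup\{\delta\})^m$ is ordered lexicographically, i.e. $(k_1,\ldots,k_m)<(l_1,\ldots,l_m)$ if and only if the tuples differ and $k_i<l_i$ in $\Lambda\cup\{\delta\}$ for the least $i$ with $k_i\neq l_i$. -}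

module Defs where

open import Data.Fin.Base as Fin using (Fin; zero; suc)
import Data.Fin.Properties as Fin
open import Data.List.Base using (List; []; _∷_)
open import Data.List.Relation.Binary.Lex.NonStrict using (Lex-≤)
import Data.List.Relation.Binary.Pointwise as ListPW
open import Data.List.Relation.Unary.Linked using (Linked)
open import Data.Nat.Base using (ℕ; s<s; z<s)
open import Data.Product using (Σ; ∃; ∃!; _×_; _,_; proj₁; proj₂)
open import Data.Vec.Base using (Vec; []; _∷_; lookup; tabulate; replicate; _[_]≔_)
open import Data.Vec.Properties using (lookup∘tabulate)
import Data.Vec.Relation.Binary.Lex.NonStrict as VecLex
open import Data.Vec.Relation.Binary.Pointwise.Inductive as PW using (Pointwise; []; _∷_)
import Data.Vec.Relation.Unary.Linked as VecLinked
import Data.Vec.Relation.Unary.Linked.Properties as Linkedₚ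
open import Function.Bundles using (Func; Inverse)
open import Function.Properties.Inverse using (Inverse⇒Injection)
open import Level using (Level; _⊔_)
open import Relation.Binary.Bundles using (Poset; Setoid)
import Relation.Binary.Construct.Add.Infimum.NonStrict as AddInfimum
import Relation.Binary.Construct.Add.Infimum.Equality as AddInfimumEq
import Relation.Binary.Construct.On as On
open import Relation.Binary.Core using (Rel)
open import Relation.Binary.Definitions
  using (Antisymmetric; Decidable; Reflexive; tri<; tri≈; tri>)
import Relation.Binary.Properties.Poset as Posetₚ
open import Relation.Binary.PropositionalEquality using (_≡_; refl; setoid)
open import Relation.Nullary using (¬_; yes; no; contradiction)
open import Relation.Nullary.Construct.Add.Infimum using (⊥₋; [_])

private
  variable
    a r c ℓ₁ ℓ₂ c′ ℓ₁′ ℓ₂′ : Level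

------------------------------------------------------------------------
-- Finite and bounded posets, cover relations

module _ (P : Poset c ℓ₁ ℓ₂) where

  open Poset P
  open Posetₚ P using (_<_)

  Finite : Set (c ⊔ ℓ₁)
  Finite = ∃ λ n → Inverse Eq.setoid (setoid (Fin n))

  Minimal : Carrier → Set (c ⊔ ℓ₁ ⊔ ℓ₂)
  Minimal x = ∀ z → ¬ z < x

  Maximal : Carrier → Set (c ⊔ ℓ₁ ⊔ ℓ₂)
  Maximal x = ∀ z → ¬ x < z

  Bounded : Set (c ⊔ ℓ₁ ⊔ ℓ₂)
  Bounded = ∃! _≈_ Minimal × ∃! _≈_ Maximal

  record Covers (x y : Carrier) : Set (c ⊔ ℓ₁ ⊔ ℓ₂) where
    constructor covers
    field
      less    : x < y
      between : ¬ (∃ λ z → x < z × z < y)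

  syntax Covers P x y = x ⋖[ P ] y

  Edge : Set (c ⊔ ℓ₁ ⊔ ℓ₂)
  Edge = ∃ λ x → ∃ λ y → Covers x y

  -- An edge is determined by its endpoints; the proof of the cover
  -- relation is disregarded.
  edges : Setoid (c ⊔ ℓ₁ ⊔ ℓ₂) ℓ₁
  edges = record
    { Carrier       = Edge
    ; _≈_           = λ (x , y , _) (x′ , y′ , _) → x ≈ x′ × y ≈ y′
    ; isEquivalence = record
      { refl  = Eq.refl , Eq.refl
      ; sym   = λ (p , q) → Eq.sym p , Eq.sym q
      ; trans = λ (p , q) (p′ , q′) → Eq.trans p p′ , Eq.trans q q′
      }
    }

  -- Maximal chains of the interval [x,y]: intervals are convex, so covering
  -- in [x,y] is covering in P, and every element of such a chain lies in [x,y].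
  data MaximalChain : Carrier → Carrier → Set (c ⊔ ℓ₁ ⊔ ℓ₂) where
    stop : ∀ {x y} → x ≈ y → MaximalChain x y
    step : ∀ {x y z} → Covers x z → MaximalChain z y → MaximalChain x y

  elements : ∀ {x y} → MaximalChain x y → List Carrier
  elements (stop {x} _)   = x ∷ []
  elements (step {x} _ C) = x ∷ elements C

  SameChain : ∀ {x y} → Rel (MaximalChain x y) (c ⊔ ℓ₁)
  SameChain C D = ListPW.Pointwise _≈_ (elements C) (elements D)

------------------------------------------------------------------------
-- EL-labelings

EdgeLabeling : Poset c ℓ₁ ℓ₂ → Poset c′ ℓ₁′ ℓ₂′ → Set _
EdgeLabeling P Λ = Func (edges P) (Poset.Eq.setoid Λ)

module _ (P : Poset c ℓ₁ ℓ₂) (Λ : Poset c′ ℓ₁′ ℓ₂′) (ƛ : EdgeLabeling P Λ) where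

  open Poset P using (Carrier; _≤_)
  private module Λ = Poset Λ

  labels : ∀ {x y} → MaximalChain P x y → List Λ.Carrier
  labels (stop _)                 = []
  labels (step {x} {z = z} x⋖z C) = Func.to ƛ (x , z , x⋖z) ∷ labels C

  Rising : ∀ {x y} → MaximalChain P x y → Set (c′ ⊔ ℓ₁′ ⊔ ℓ₂′)
  Rising C = Linked (Posetₚ._<_ Λ) (labels C)

  Precedes : ∀ {x y} → Rel (MaximalChain P x y) (c′ ⊔ ℓ₁′ ⊔ ℓ₂′)
  Precedes C D = Lex-≤ Λ._≈_ Λ._≤_ (labels C) (labels D)

  record IsELLabeling : Set (c ⊔ ℓ₁ ⊔ ℓ₂ ⊔ c′ ⊔ ℓ₁′ ⊔ ℓ₂′) where
    field
      bounded : Bounded P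
      rising  : ∀ {x y} → x ≤ y →
                Σ (∃! (SameChain P {x} {y}) Rising) λ (C , _) →
                  ∀ D → ¬ SameChain P C D → Precedes C D

------------------------------------------------------------------------
-- Multichains

module _ {A : Set a} {R : Rel A r} where

  pointwise : ∀ {n} {xs ys : Vec A n} →
              (∀ i → R (lookup xs i) (lookup ys i)) → Pointwise R xs ys
  pointwise {xs = []}    {[]}    p = []
  pointwise {xs = _ ∷ _} {_ ∷ _} p = p zero ∷ pointwise (λ i → p (suc i))

  linked : ∀ {n} {xs : Vec A n} →
           (∀ {i j} → i Fin.< j → R (lookup xs i) (lookup xs j)) →
           VecLinked.Linked R xs
  linked {xs = []}         p = VecLinked.[]
  linked {xs = x ∷ []}     p = VecLinked.[-]
  linked {xs = x ∷ y ∷ xs} p =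
    p {zero} {suc zero} z<s VecLinked.∷ linked (λ {i} {j} i<j → p {suc i} {suc j} (s<s i<j))

  []≔-cong : Reflexive R → ∀ {n} (xs : Vec A n) i {x y} → R x y →
             Pointwise R (xs [ i ]≔ x) (xs [ i ]≔ y)
  []≔-cong rfl (_ ∷ xs) zero    p = p ∷ PW.refl rfl
  []≔-cong rfl (_ ∷ xs) (suc i) p = rfl ∷ []≔-cong rfl xs i p

module _ (P : Poset c ℓ₁ ℓ₂) (m : ℕ) where

  open Poset P

  Multichain : Set (c ⊔ ℓ₂)
  Multichain = ∃ λ (xs : Vec Carrier m) → VecLinked.Linked _≤_ xs

  pointwisePoset : Poset c (c ⊔ ℓ₁) (c ⊔ ℓ₂)
  pointwisePoset = record
    { Carrier        = Vec Carrier m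
    ; _≈_            = Pointwise _≈_
    ; _≤_            = Pointwise _≤_
    ; isPartialOrder = record
      { isPreorder = record
        { isEquivalence = PW.isEquivalence isEquivalence m
        ; reflexive     = PW.map reflexive
        ; trans         = PW.trans trans
        }
      ; antisym = pw-antisym
      }
    }
    where
    pw-antisym : ∀ {n} → Antisymmetric (Pointwise _≈_ {n}) (Pointwise _≤_)
    pw-antisym []       []       = []
    pw-antisym (p ∷ ps) (q ∷ qs) = antisym p q ∷ pw-antisym ps qs

  multichains : Poset (c ⊔ ℓ₂) (c ⊔ ℓ₁) (c ⊔ ℓ₂)
  multichains = On.poset {B = Multichain} pointwisePoset proj₁

module _ (P : Poset c ℓ₁ ℓ₂) {m : ℕ} where

  open Poset P hiding (refl)
  open Posetₚ P using (_<_)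

  infixl 9 _‼_
  _‼_ : Multichain P m → Fin m → Carrier
  (xs , _) ‼ i = lookup xs i

  DifferAt : Multichain P m → Multichain P m → Fin m → Set ℓ₁
  DifferAt x y i = ¬ x ‼ i ≈ y ‼ i

  ‼-mono : ∀ (x : Multichain P m) {i j} → i Fin.< j → x ‼ i ≤ x ‼ j
  ‼-mono (_ , l) = Linkedₚ.lookup⁺ trans l

  fromFunction : (f : Fin m → Carrier) → (∀ {i j} → i Fin.< j → f i ≤ f j) →
                 Multichain P m
  fromFunction f mono = tabulate f , linked mono′
    where
    mono′ : ∀ {i j} → i Fin.< j → lookup (tabulate f) i ≤ lookup (tabulate f) j
    mono′ {i} {j} i<j rewrite lookup∘tabulate f i | lookup∘tabulate f j = mono i<j

  noBetween : ∀ {x y} → x ⋖[ multichains P m ] y → (f : Fin m → Carrier) →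
              (∀ {i j} → i Fin.< j → f i ≤ f j) →
              (∀ i → x ‼ i ≤ f i) → (∀ i → f i ≤ y ‼ i) →
              (∃ λ i → ¬ x ‼ i ≈ f i) → ¬ (∃ λ i → ¬ f i ≈ y ‼ i)
  noBetween {x} {y} (covers _ ∄z) f mono x≤f f≤y (i , x≉f) (j , f≉y) =
    ∄z (w , (pointwise x≤w , λ x≈w → x≉f (x≈f x≈w)) ,
            (pointwise w≤y , λ w≈y → f≉y (f≈y w≈y)))
    where
    w : Multichain P m
    w = fromFunction f mono
    x≤w : ∀ k → x ‼ k ≤ w ‼ k
    x≤w k rewrite lookup∘tabulate f k = x≤f k
    w≤y : ∀ k → w ‼ k ≤ y ‼ k
    w≤y k rewrite lookup∘tabulate f k = f≤y k
    x≈f : Pointwise _≈_ (proj₁ x) (proj₁ w) → x ‼ i ≈ f i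
    x≈f x≈w with p ← PW.lookup x≈w i rewrite lookup∘tabulate f i = p
    f≈y : Pointwise _≈_ (proj₁ w) (proj₁ y) → f j ≈ y ‼ j
    f≈y w≈y with p ← PW.lookup w≈y j rewrite lookup∘tabulate f j = p

  differOnce : ∀ {x y} → x ⋖[ multichains P m ] y → ∀ {i j} →
               DifferAt x y i → DifferAt x y j → ¬ i Fin.< j
  differOnce {x} {y} x⋖y@(covers (x≤y , _) _) {i} {j} dᵢ dⱼ i<j =
    noBetween x⋖y f mono x≤f f≤y (j , x≉f) (i , f≉y)
    where
    f : Fin m → Carrier
    f k with i Fin.<? k
    ... | yes _ = y ‼ k
    ... | no  _ = x ‼ k
    mono : ∀ {k l} → k Fin.< l → f k ≤ f l
    mono {k} {l} k<l with i Fin.<? k | i Fin.<? l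
    ... | yes _   | yes _  = ‼-mono y k<l
    ... | yes i<k | no i≮l = contradiction (Fin.<-trans i<k k<l) i≮l
    ... | no _    | yes _  = trans (‼-mono x k<l) (PW.lookup x≤y l)
    ... | no _    | no _   = ‼-mono x k<l
    x≤f : ∀ k → x ‼ k ≤ f k
    x≤f k with i Fin.<? k
    ... | yes _ = PW.lookup x≤y k
    ... | no  _ = Poset.refl P
    f≤y : ∀ k → f k ≤ y ‼ k
    f≤y k with i Fin.<? k
    ... | yes _ = Poset.refl P
    ... | no  _ = PW.lookup x≤y k
    x≉f : ¬ x ‼ j ≈ f j
    x≉f with i Fin.<? j
    ... | yes _  = dⱼ
    ... | no i≮j = contradiction i<j i≮j
    f≉y : ¬ f i ≈ y ‼ i
    f≉y with i Fin.<? i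
    ... | yes i<i = contradiction i<i (Fin.<-irrefl refl)
    ... | no _    = dᵢ

  differUnique : ∀ {x y} → x ⋖[ multichains P m ] y → ∀ {i j} →
                 DifferAt x y i → DifferAt x y j → i ≡ j
  differUnique x⋖y {i} {j} dᵢ dⱼ with Fin.<-cmp i j
  ... | tri< i<j _ _ = contradiction i<j (differOnce x⋖y dᵢ dⱼ)
  ... | tri≈ _ i≡j _ = i≡j
  ... | tri> _ _ j<i = contradiction j<i (differOnce x⋖y dⱼ dᵢ)

  coverAt : ∀ {x y} → x ⋖[ multichains P m ] y → ∀ {j} →
            DifferAt x y j → (x ‼ j) ⋖[ P ] (y ‼ j)
  coverAt {x} {y} x⋖y@(covers (x≤y , _) _) {j} dⱼ = covers (PW.lookup x≤y j , dⱼ) between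
    where
    between : ¬ (∃ λ z → x ‼ j < z × z < y ‼ j)
    between (z , (xⱼ≤z , xⱼ≉z) , (z≤yⱼ , z≉yⱼ)) =
      noBetween x⋖y f mono x≤f f≤y (j , x≉f) (j , f≉y)
      where
      f : Fin m → Carrier
      f k with Fin.<-cmp k j
      ... | tri< _ _ _ = x ‼ k
      ... | tri≈ _ _ _ = z
      ... | tri> _ _ _ = y ‼ k
      mono : ∀ {k l} → k Fin.< l → f k ≤ f l
      mono {k} {l} k<l with Fin.<-cmp k j | Fin.<-cmp l j
      ... | tri< _ _ _    | tri< _ _ _    = ‼-mono x k<l
      ... | tri< k<j _ _  | tri≈ _ _ _    = trans (‼-mono x k<j) xⱼ≤z
      ... | tri< _ _ _    | tri> _ _ _    = trans (‼-mono x k<l) (PW.lookup x≤y l)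
      ... | tri≈ _ refl _ | tri< _ _ l≯j  = contradiction k<l l≯j
      ... | tri≈ _ refl _ | tri≈ _ _ l≯j  = contradiction k<l l≯j
      ... | tri≈ _ refl _ | tri> _ _ j<l  = trans z≤yⱼ (‼-mono y j<l)
      ... | tri> _ _ j<k  | tri< l<j _ _  = contradiction (Fin.<-trans (Fin.<-trans j<k k<l) l<j) (Fin.<-irrefl refl)
      ... | tri> _ _ j<k  | tri≈ _ refl _ = contradiction (Fin.<-trans j<k k<l) (Fin.<-irrefl refl)
      ... | tri> _ _ _    | tri> _ _ _    = ‼-mono y k<l
      x≤f : ∀ k → x ‼ k ≤ f k
      x≤f k with Fin.<-cmp k j
      ... | tri< _ _ _    = Poset.refl P
      ... | tri≈ _ refl _ = xⱼ≤z
      ... | tri> _ _ _    = PW.lookup x≤y k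
      f≤y : ∀ k → f k ≤ y ‼ k
      f≤y k with Fin.<-cmp k j
      ... | tri< _ _ _    = PW.lookup x≤y k
      ... | tri≈ _ refl _ = z≤yⱼ
      ... | tri> _ _ _    = Poset.refl P
      x≉f : ¬ x ‼ j ≈ f j
      x≉f with Fin.<-cmp j j
      ... | tri< _ j≢j _ = contradiction refl j≢j
      ... | tri≈ _ _ _   = xⱼ≉z
      ... | tri> _ j≢j _ = contradiction refl j≢j
      f≉y : ¬ f j ≈ y ‼ j
      f≉y with Fin.<-cmp j j
      ... | tri< _ j≢j _ = contradiction refl j≢j
      ... | tri≈ _ _ _   = z≉yⱼ
      ... | tri> _ j≢j _ = contradiction refl j≢j

  ≈-dec : Finite P → Decidable _≈_
  ≈-dec (_ , P↔Fin) = Fin.inj⇒≟ (Inverse⇒Injection P↔Fin)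

  differIndex : Finite P → ∀ {x y} → x ⋖[ multichains P m ] y →
                ∃! _≡_ (DifferAt x y)
  differIndex fin {x} {y} x⋖y@(covers (_ , x≉y) _) =
    let j , dⱼ = Fin.¬∀⟶∃¬ m _ (λ i → ≈-dec fin (x ‼ i) (y ‼ i))
                   (λ x≈y → x≉y (pointwise x≈y))
    in j , dⱼ , differUnique x⋖y dⱼ

------------------------------------------------------------------------
-- The product labeling

addLeast : Poset c ℓ₁ ℓ₂ → Poset c (c ⊔ ℓ₁) (c ⊔ ℓ₂)
addLeast Λ = record
  { isPartialOrder = AddInfimum.≤₋-isPartialOrder (Poset._≤_ Λ) (Poset.isPartialOrder Λ) }

-- Lex-≤ on vectors is built from the strict part of the order on Λ ∪ {δ}; the
-- strict part of the resulting order is the lexicographic _<_.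
productLabels : Poset c ℓ₁ ℓ₂ → ℕ → Poset c (c ⊔ ℓ₁) (c ⊔ ℓ₁ ⊔ ℓ₂)
productLabels Λ m = VecLex.≤-poset (addLeast Λ) m

module _ (P : Poset c ℓ₁ ℓ₂) (fin : Finite P) (Λ : Poset c′ ℓ₁′ ℓ₂′)
         (ƛ : EdgeLabeling P Λ) (m : ℕ) where

  -- The formal symbol δ is ⊥₋.  The label does not depend on the choice of j,
  -- which is unique by differUnique, nor on the proofs (see labelAt-cong).
  labelAt : ∀ {x y} → x ⋖[ multichains P m ] y → ∀ j → DifferAt P x y j →
            Poset.Carrier (productLabels Λ m)
  labelAt {x , _} {y , _} x⋖y j dⱼ =
    replicate m ⊥₋ [ j ]≔ [ Func.to ƛ (lookup x j , lookup y j , coverAt P x⋖y dⱼ) ]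

  productLabel : Edge (multichains P m) → Poset.Carrier (productLabels Λ m)
  productLabel (x , y , x⋖y) =
    let j , dⱼ , _ = differIndex P fin x⋖y in labelAt x⋖y j dⱼ

  labelAt-cong : ∀ {x x′ y y′} (x⋖y : x ⋖[ multichains P m ] y)
                 (x′⋖y′ : x′ ⋖[ multichains P m ] y′) →
                 Poset._≈_ (multichains P m) x x′ →
                 Poset._≈_ (multichains P m) y y′ →
                 ∀ j j′ (dⱼ : DifferAt P x y j) (dⱼ′ : DifferAt P x′ y′ j′) →
                 Poset._≈_ (productLabels Λ m)
                   (labelAt x⋖y j dⱼ) (labelAt x′⋖y′ j′ dⱼ′)
  labelAt-cong x⋖y x′⋖y′ x≈x′ y≈y′ j j′ dⱼ dⱼ′
    with differUnique P x⋖y dⱼ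
           (λ xⱼ≈yⱼ → dⱼ′ (Eq.trans (Eq.sym (PW.lookup x≈x′ j′))
                            (Eq.trans xⱼ≈yⱼ (PW.lookup y≈y′ j′))))
    where open Poset P using (module Eq)
  ... | refl = []≔-cong (Poset.Eq.refl (addLeast Λ)) (replicate m ⊥₋) j
                 AddInfimumEq.[ Func.cong ƛ (PW.lookup x≈x′ j , PW.lookup y≈y′ j) ]

  productLabeling : EdgeLabeling (multichains P m) (productLabels Λ m)
  productLabeling = record { to = productLabel ; cong = λ {e} {e′} → cong-label {e} {e′} }
    where
    cong-label : ∀ {e e′} → Setoid._≈_ (edges (multichains P m)) e e′ →
                 Poset._≈_ (productLabels Λ m) (productLabel e) (productLabel e′)
    cong-label {x , y , x⋖y} {x′ , y′ , x′⋖y′} (x≈x′ , y≈y′) =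
      let j  , dⱼ  , _ = differIndex P fin x⋖y
          j′ , dⱼ′ , _ = differIndex P fin x′⋖y′
      in labelAt-cong x⋖y x′⋖y′ x≈x′ y≈y′ j j′ dⱼ dⱼ′

{-# OPTIONS --safe #-}

-- An edge-labeling is an EL-labeling as soon as every interval has a rising
-- chain and the first step of a rising chain beats every other atom of the
-- interval strictly: uniqueness and lexicographic minimality follow by
-- induction along the chains.  This first-step property passes from λ to λᵐ.
-- Since δ is least, a label at a later position is smaller, so a rising chain
-- of multichains raises the last coordinate first and the first one last, and
-- raises each coordinate along a rising chain of P.  Conversely, raising the
-- coordinates in that order stays inside the multichains and yields a rising chain.

module Submission where

open import Defs
open import Data.Fin.Base as Fin using (Fin; zero; suc; toℕ; fromℕ<)
open import Data.Fin.Induction using (spo-wellFounded)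
import Data.Fin.Properties as Fin
open import Data.List.Base using ([]; _∷_)
open import Data.List.Relation.Binary.Lex.NonStrict using (Lex-≤; base; halt; this; next)
open import Data.List.Relation.Binary.Pointwise as ListPW using ([]; _∷_)
open import Data.List.Relation.Unary.Linked using (Linked; []; [-]; _∷_; tail)
open import Data.Nat.Base as ℕ using (ℕ; NonZero; zero; suc)
import Data.Nat.Properties as ℕ
open import Data.Product using (Σ-syntax; ∃; ∃!; _×_; _,_; proj₁; proj₂)
open import Data.Sum.Base using (_⊎_; inj₁; inj₂)
open import Data.Unit.Base using (tt)
open import Data.Vec.Base using (lookup; replicate; _[_]≔_)
open import Data.Vec.Properties using (lookup∘tabulate; lookup∘update; lookup∘update′)
import Data.Vec.Relation.Binary.Lex.NonStrict as VecLex
import Data.Vec.Relation.Binary.Pointwise.Inductive as PW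
open import Effect.Monad using (RawMonad)
open import Function.Base using (_∘_)
open import Function.Bundles using (Func; Inverse)
open import Induction.WellFounded using (WellFounded; Acc; acc)
open import Level using (Level)
open import Relation.Binary.Bundles using (Poset)
import Relation.Binary.Construct.Add.Infimum.Equality as AddInfimumEq
import Relation.Binary.Construct.Add.Infimum.NonStrict as AddInfimum
open import Relation.Binary.Definitions using (Decidable; tri<; tri≈; tri>)
import Relation.Binary.Properties.Poset as Posetₚ
open import Relation.Binary.PropositionalEquality as ≡ using (_≡_; _≢_; refl)
open import Relation.Nullary using (¬_; Dec; yes; no; contradiction)
open import Relation.Nullary.Construct.Add.Infimum using (⊥₋; [_])
open import Relation.Nullary.Decidable using (decidable-stable)
open import Relation.Nullary.Negation using (¬¬-Monad)

private
  variable
    c ℓ₁ ℓ₂ c′ ℓ₁′ ℓ₂′ : Level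

-- Bounded posets

module _ (P : Poset c ℓ₁ ℓ₂) where

  open Poset P hiding (refl)
  open Posetₚ P using (_<_; ≥-poset; <-irrefl; <-trans; <-respˡ-≈; <-respʳ-≈)

  -- In the opposite order `≤` is flipped but `≉` keeps its sides, so the two notions match only up
  -- to symmetry. This carries the results on minimal elements over to maximal ones.
  maximal⇒minimal : ∀ {x} → Maximal P x → Minimal ≥-poset x
  maximal⇒minimal max z (x≤z , z≉x) = max z (x≤z , z≉x ∘ Eq.sym)

  minimal⇒maximal : ∀ {x} → Minimal ≥-poset x → Maximal P x
  minimal⇒maximal min z (x≤z , x≉z) = min z (x≤z , x≉z ∘ Eq.sym)

  <-wellFounded : Finite P → WellFounded _<_
  <-wellFounded (n , P↔Fin) x = accessible (Eq.sym (strictlyInverseʳ x)) (wf (to x))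
    where
    open Inverse P↔Fin
    _⊏_ : Fin n → Fin n → Set _
    i ⊏ j = from i < from j
    wf : WellFounded _⊏_
    wf = spo-wellFounded (record
      { isEquivalence = ≡.isEquivalence
      ; irrefl        = λ { refl → <-irrefl Eq.refl }
      ; trans         = <-trans
      ; <-resp-≈      = (λ { refl p → p }) , (λ { refl p → p })
      })
    -- `from (to x)` is only `≈ x`, so accessibility is transferred to every representative of the
    -- class.
    accessible : ∀ {x i} → x ≈ from i → Acc _⊏_ i → Acc _<_ x
    accessible {x} {i} x≈i (acc rs) = acc λ {z} z<x →
      accessible (Eq.sym (strictlyInverseʳ z))
        (rs (<-respˡ-≈ (Eq.sym (strictlyInverseʳ z)) (<-respʳ-≈ x≈i z<x)))

  -- The order of a finite poset need not be decidable, so a minimal element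
  -- below x can be had only up to double negation.
  uniqueMinimal⇒least : Finite P → ((0̂ , _) : ∃! _≈_ (Minimal P)) → ∀ x → ¬ ¬ 0̂ ≤ x
  uniqueMinimal⇒least fin (0̂ , _ , unique) x = go (<-wellFounded fin x)
    where
    go : ∀ {x} → Acc _<_ x → ¬ ¬ 0̂ ≤ x
    go (acc rs) 0≰x = 0≰x (reflexive (unique λ z z<x →
      go (rs z<x) λ 0≤z → 0≰x (trans 0≤z (proj₁ z<x))))

  least⇒uniqueMinimal : Decidable _≈_ → ∀ {e} → Minimal P e →
                        (∀ x → ¬ ¬ e ≤ x) → ∃! _≈_ (Minimal P)
  least⇒uniqueMinimal _≟_ {e} min least = e , min , λ {x} min-x →
    decidable-stable (e ≟ x) λ e≉x → least x λ e≤x → min-x e (e≤x , e≉x)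

-- Bounds of the poset of multichains

module _ (P : Poset c ℓ₁ ℓ₂) (fin : Finite P) (m : ℕ) where

  open Poset P hiding (refl)
  private
    Q = multichains P m
    module Q = Poset Q

    _≟_ : Decidable _≈_
    _≟_ = ≈-dec P {m} fin

  constant : Carrier → Multichain P m
  constant x = fromFunction P (λ _ → x) λ _ → Poset.refl P

  constant-‼ : ∀ x i → x ≈ _‼_ P (constant x) i
  constant-‼ x i = Eq.reflexive (≡.sym (lookup∘tabulate (λ _ → x) i))

  multichains-≟ : Decidable Q._≈_
  multichains-≟ (x , _) (y , _) = PW.decidable _≟_ x y

  -- There are only finitely many coordinates; this joins the doubly negated componentwise bounds
  -- into one bound on multichains.
  ¬¬-sequence : ∀ {R : Fin m → Set ℓ₂} → (∀ i → ¬ ¬ R i) → ¬ ¬ (∀ i → R i)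
  ¬¬-sequence = Fin.sequence (RawMonad.rawApplicative ¬¬-Monad)

  multichains-uniqueMinimal : ∃! _≈_ (Minimal P) → ∃! Q._≈_ (Minimal Q)
  multichains-uniqueMinimal 0!@(0̂ , min , _) =
    least⇒uniqueMinimal Q multichains-≟ {constant 0̂}
      (λ z (z≤0 , z≉0) → z≉0 (pointwise λ i → decidable-stable (_ ≟ _) λ zᵢ≉0 →
        min _ (≤-respʳ-≈ (Eq.sym (constant-‼ 0̂ i)) (PW.lookup z≤0 i)
              , λ e → zᵢ≉0 (Eq.trans e (constant-‼ 0̂ i)))))
      (λ x 0≰x → ¬¬-sequence (λ i → uniqueMinimal⇒least P fin 0! (_‼_ P x i)) λ 0≤x →
        0≰x (pointwise λ i → ≤-respˡ-≈ (constant-‼ 0̂ i) (0≤x i)))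

  multichains-uniqueMaximal : ∃! _≈_ (Maximal P) → ∃! Q._≈_ (Maximal Q)
  multichains-uniqueMaximal (1̂ , max , unique) =
    let e , min , unique′ = least⇒uniqueMinimal (Posetₚ.≥-poset Q) multichains-≟ {constant 1̂}
          (λ z (1≤z , z≉1) → z≉1 (pointwise λ i → decidable-stable (_ ≟ _) λ zᵢ≉1 →
            max _ (≤-respˡ-≈ (Eq.sym (constant-‼ 1̂ i)) (PW.lookup 1≤z i)
                  , λ e → zᵢ≉1 (Eq.trans (Eq.sym e) (constant-‼ 1̂ i)))))
          (λ x x≰1 → ¬¬-sequence (λ i → uniqueMinimal⇒least (Posetₚ.≥-poset P) fin
              (1̂ , maximal⇒minimal P max , unique ∘ minimal⇒maximal P) (_‼_ P x i)) λ x≤1 →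
            x≰1 (pointwise λ i → ≤-respʳ-≈ (constant-‼ 1̂ i) (x≤1 i)))
    in e , minimal⇒maximal Q {e} min , λ {x} max-x → unique′ {x} (maximal⇒minimal Q {x} max-x)

  multichains-bounded : Bounded P → Bounded Q
  multichains-bounded (0! , 1!) = multichains-uniqueMinimal 0! , multichains-uniqueMaximal 1!

-- Chains and the first-step property

module _ (P : Poset c ℓ₁ ℓ₂) where

  open Poset P
  open Posetₚ P using (_<_; <-respˡ-≈; <-respʳ-≈)

  Covers-resp-≈ : ∀ {x x′ y y′} → x ≈ x′ → y ≈ y′ → x ⋖[ P ] y → x′ ⋖[ P ] y′
  Covers-resp-≈ x≈x′ y≈y′ (covers x<y ∄z) =
    covers (<-respʳ-≈ y≈y′ (<-respˡ-≈ x≈x′ x<y)) λ (z , x′<z , z<y′) →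
      ∄z (z , <-respˡ-≈ (Eq.sym x≈x′) x′<z , <-respʳ-≈ (Eq.sym y≈y′) z<y′)

  chain⇒≤ : ∀ {x y} → MaximalChain P x y → x ≤ y
  chain⇒≤ (stop x≈y)                    = reflexive x≈y
  chain⇒≤ (step (covers (x≤z , _) _) C) = trans x≤z (chain⇒≤ C)

  ⋖∧≤⇒≉ : ∀ {x y z} → x ⋖[ P ] z → z ≤ y → ¬ x ≈ y
  ⋖∧≤⇒≉ (covers (x≤z , x≉z) _) z≤y x≈y =
    x≉z (antisym x≤z (≤-respʳ-≈ (Eq.sym x≈y) z≤y))

  ⋖-minimal : Decidable _≈_ → ∀ {x y z} → x ⋖[ P ] y → x < z → z ≤ y → z ≈ y
  ⋖-minimal _≟_ {z = z} (covers _ ∄z) x<z z≤y =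
    decidable-stable (_ ≟ _) λ z≉y → ∄z (z , x<z , z≤y , z≉y)

module _ (P : Poset c ℓ₁ ℓ₂) (Λ : Poset c′ ℓ₁′ ℓ₂′) (ƛ : EdgeLabeling P Λ) where

  open Poset P using (_≈_; _≤_; module Eq)
  private
    module P = Poset P
    module Λ = Poset Λ
    module Λₚ = Posetₚ Λ

    label : ∀ {x y} → x ⋖[ P ] y → Λ.Carrier
    label x⋖y = Func.to ƛ (_ , _ , x⋖y)

  -- Only atoms of the interval are compared, not whole chains, so the property can be checked one
  -- coordinate at a time.
  FirstStep : Set _
  FirstStep = ∀ {x y z z′} (x⋖z : x ⋖[ P ] z) (C : MaximalChain P z y) →
              Rising P Λ ƛ (step x⋖z C) →
              (x⋖z′ : x ⋖[ P ] z′) → z′ ≤ y →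
              z ≈ z′ ⊎ label x⋖z Λₚ.< label x⋖z′

  -- If the first labels agreed, then D would be rising along with C, because
  -- its second label is at least that of C.
  precedes⇒label< : Decidable _≈_ → ∀ {x y z z′} (x⋖z : x ⋖[ P ] z) (C : MaximalChain P z y)
                    (x⋖z′ : x ⋖[ P ] z′) (D : MaximalChain P z′ y) → ¬ z ≈ z′ →
                    Rising P Λ ƛ (step x⋖z C) → Rising P Λ ƛ D →
                    ¬ Rising P Λ ƛ (step x⋖z′ D) →
                    Precedes P Λ ƛ (step x⋖z C) (step x⋖z′ D) →
                    label x⋖z Λₚ.< label x⋖z′
  precedes⇒label< _≟_ _ _ _ _ _ _ _ _ (this lt) = lt
  -- Here `y ≈ z` covers `x`, so `x < z′ ≤ y` forces `z′ ≈ z`.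
  precedes⇒label< _≟_ x⋖z (stop z≈y) x⋖z′ D z≉z′ _ _ _ (next _ _) =
    contradiction (Eq.sym (⋖-minimal P _≟_ x⋖z (Covers.less x⋖z′)
                            (P.≤-respʳ-≈ (Eq.sym z≈y) (chain⇒≤ P D)))) z≉z′
  precedes⇒label< _≟_ x⋖z (step _ _) x⋖z′ (step z′⋖w D) z≉z′ (lt ∷ _) D↑ ¬↑ (next eq lex) =
    contradiction (second lex ∷ D↑) ¬↑
    where
    second : ∀ {as bs} → Lex-≤ Λ._≈_ Λ._≤_ (_ ∷ as) (_ ∷ bs) → label x⋖z′ Λₚ.< label z′⋖w
    second (this lt′)  = Λₚ.<-respˡ-≈ eq (Λₚ.<-trans lt lt′)
    second (next eq′ _) = Λₚ.<-respˡ-≈ eq (Λₚ.<-respʳ-≈ eq′ lt)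

  sameChain⇒second≈ : ∀ {x y z z′} (x⋖z : x ⋖[ P ] z) (C : MaximalChain P z y)
                      (x⋖z′ : x ⋖[ P ] z′) (D : MaximalChain P z′ y) →
                      SameChain P (step x⋖z C) (step x⋖z′ D) → z ≈ z′
  sameChain⇒second≈ _ (stop _)   _ (stop _)   (_ ∷ z≈z′ ∷ _) = z≈z′
  sameChain⇒second≈ _ (stop _)   _ (step _ _) (_ ∷ z≈z′ ∷ _) = z≈z′
  sameChain⇒second≈ _ (step _ _) _ (stop _)   (_ ∷ z≈z′ ∷ _) = z≈z′
  sameChain⇒second≈ _ (step _ _) _ (step _ _) (_ ∷ z≈z′ ∷ _) = z≈z′

  -- Let `R` be the part after `x` of the given rising chain of [x,y], and `D` the rising chain of
  -- [z′,y]. By uniqueness `R` starts at `z` up to `≈`. If `z′` differs from `z`, then `step x⋖z′ D`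
  -- is another chain of [x,y], hence not rising and preceded by the rising one; `precedes⇒label<`
  -- applies.
  EL⇒FirstStep : Decidable _≈_ → IsELLabeling P Λ ƛ → FirstStep
  EL⇒FirstStep _≟_ el {z = z} {z′} x⋖z C C↑ x⋖z′ z′≤y
    with IsELLabeling.rising el (P.trans (proj₁ (Covers.less x⋖z′)) z′≤y)
       | IsELLabeling.rising el z′≤y
       | z ≟ z′
  ... | _ | _ | yes z≈z′ = inj₁ z≈z′
  ... | (stop x≈y , _) , _ | _ | no _ = contradiction x≈y (⋖∧≤⇒≉ P x⋖z (chain⇒≤ P C))
  ... | (step {z = r} x⋖r R , R↑ , unique) , first | (D , D↑ , _) , _ | no z≉z′ =
    inj₂ (Λₚ.<-respˡ-≈ (Func.cong ƛ (Eq.refl , r≈z))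
      (precedes⇒label< _≟_ x⋖r R x⋖z′ D r≉z′ R↑ D↑ (≁ ∘ unique) (first (step x⋖z′ D) ≁)))
    where
    r≈z : r ≈ z
    r≈z = sameChain⇒second≈ x⋖r R x⋖z C (unique C↑)
    r≉z′ : ¬ r ≈ z′
    r≉z′ r≈z′ = z≉z′ (Eq.trans (Eq.sym r≈z) r≈z′)
    ≁ : ¬ SameChain P (step x⋖r R) (step x⋖z′ D)
    ≁ = r≉z′ ∘ sameChain⇒second≈ x⋖r R x⋖z′ D

  module _ (firstStep : FirstStep) where

    -- The starting points may differ up to `≈`, because after a common first step the tails start
    -- at `z` and `w` with only `z ≈ w`.
    rising⇒precedes : ∀ {x x′ y} → x ≈ x′ → (C : MaximalChain P x y) → Rising P Λ ƛ C →
                      (D : MaximalChain P x′ y) →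
                      Lex-≤ Λ._≈_ Λ._≤_ (labels P Λ ƛ C) (labels P Λ ƛ D)
    rising⇒precedes x≈x′ (stop _)   _ (stop _)   = base tt
    rising⇒precedes x≈x′ (stop _)   _ (step _ _) = halt
    rising⇒precedes x≈x′ (step x⋖z C) _ (stop x′≈y) =
      contradiction (Eq.trans x≈x′ x′≈y) (⋖∧≤⇒≉ P x⋖z (chain⇒≤ P C))
    rising⇒precedes x≈x′ (step x⋖z C) C↑ (step x′⋖w D)
      with firstStep x⋖z C C↑ (Covers-resp-≈ P (Eq.sym x≈x′) Eq.refl x′⋖w) (chain⇒≤ P D)
    ... | inj₁ z≈w = next (Func.cong ƛ (x≈x′ , z≈w)) (rising⇒precedes z≈w C (tail C↑) D)
    ... | inj₂ lt  = this (Λₚ.<-respʳ-≈ (Func.cong ƛ (x≈x′ , Eq.refl)) lt)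

    rising-unique : ∀ {x x′ y} → x ≈ x′ → (C : MaximalChain P x y) → Rising P Λ ƛ C →
                    (D : MaximalChain P x′ y) → Rising P Λ ƛ D →
                    ListPW.Pointwise _≈_ (elements P C) (elements P D)
    rising-unique x≈x′ (stop _) _ (stop _) _ = x≈x′ ∷ []
    rising-unique x≈x′ (stop x≈y) _ (step x′⋖w D) _ =
      contradiction (Eq.trans (Eq.sym x≈x′) x≈y) (⋖∧≤⇒≉ P x′⋖w (chain⇒≤ P D))
    rising-unique x≈x′ (step x⋖z C) _ (stop x′≈y) _ =
      contradiction (Eq.trans x≈x′ x′≈y) (⋖∧≤⇒≉ P x⋖z (chain⇒≤ P C))
    rising-unique x≈x′ (step x⋖z C) C↑ (step x′⋖w D) D↑
      with firstStep x⋖z C C↑ (Covers-resp-≈ P (Eq.sym x≈x′) Eq.refl x′⋖w) (chain⇒≤ P D)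
         | firstStep x′⋖w D D↑ (Covers-resp-≈ P x≈x′ Eq.refl x⋖z) (chain⇒≤ P C)
    ... | inj₁ z≈w | _        = x≈x′ ∷ rising-unique z≈w C (tail C↑) D (tail D↑)
    ... | inj₂ _   | inj₁ w≈z = x≈x′ ∷ rising-unique (Eq.sym w≈z) C (tail C↑) D (tail D↑)
    -- Each first label would lie strictly below the other.
    ... | inj₂ lt  | inj₂ gt  =
      contradiction (Λₚ.<-respʳ-≈ (Func.cong ƛ (x≈x′ , Eq.refl)) lt)
        (Λₚ.<-asym (Λₚ.<-respʳ-≈ (Func.cong ƛ (Eq.sym x≈x′ , Eq.refl)) gt))

    FirstStep⇒EL : Bounded P →
                   (∀ {x y} → x ≤ y → ∃ λ (C : MaximalChain P x y) → Rising P Λ ƛ C) →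
                   IsELLabeling P Λ ƛ
    FirstStep⇒EL bounded exists = record
      { bounded = bounded
      ; rising  = λ x≤y → let C , C↑ = exists x≤y in
          (C , C↑ , λ {D} → rising-unique Eq.refl C C↑ D) ,
          λ D _ → rising⇒precedes Eq.refl C C↑ D
      }

-- Labels of multichains

module _ (Λ : Poset c ℓ₁ ℓ₂) where

  private
    module Λ = Poset Λ
    module Λₚ = Posetₚ Λ
    module Λ₋ = Poset (addLeast Λ)

    labelPoset : ℕ → Poset _ _ _
    labelPoset = productLabels Λ

  single : ∀ {m} → Fin m → Λ.Carrier → Poset.Carrier (labelPoset m)
  single {m} j a = replicate m ⊥₋ [ j ]≔ [ a ]

  single-cong : ∀ {m} (j : Fin m) {a b} → a Λ.≈ b →
                Poset._≈_ (labelPoset m) (single j a) (single j b)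
  single-cong {m} j a≈b = []≔-cong Λ₋.Eq.refl (replicate m ⊥₋) j AddInfimumEq.[ a≈b ]

  Lex-<⇒< : ∀ {m} {ks ls : Poset.Carrier (labelPoset m)} →
            VecLex.Lex-< Λ₋._≈_ Λ₋._≤_ ks ls → Posetₚ._<_ (labelPoset m) ks ls
  Lex-<⇒< ks<ls = VecLex.<⇒≤ ks<ls , λ ks≈ls → VecLex.<-irrefl ks≈ls ks<ls

  -- The first difference is at `j`, where the left tuple has δ; hence `a` and `b` are arbitrary.
  single-<-later : ∀ {m} {j k : Fin m} a b → j Fin.< k →
                   Posetₚ._<_ (labelPoset m) (single k a) (single j b)
  single-<-later a b j<k = Lex-<⇒< (go j<k)
    where
    go : ∀ {m} {j k : Fin m} → j Fin.< k →
         VecLex.Lex-< Λ₋._≈_ Λ₋._≤_ (single k a) (single j b)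
    go {j = zero}  {suc k} _         = VecLex.this (AddInfimum.⊥₋≤ _ , λ ()) refl
    go {j = suc j} {suc k} (ℕ.s≤s j<k) = VecLex.next AddInfimumEq.⊥₋≈⊥₋ (go j<k)

  single-<-mono : ∀ {m} (j : Fin m) {a b} → a Λₚ.< b →
                  Posetₚ._<_ (labelPoset m) (single j a) (single j b)
  single-<-mono j {a} {b} (a≤b , a≉b) = Lex-<⇒< (go j)
    where
    go : ∀ {m} (j : Fin m) → VecLex.Lex-< Λ₋._≈_ Λ₋._≤_ (single j a) (single j b)
    go zero    = VecLex.this (AddInfimum.[ a≤b ] , λ { AddInfimumEq.[ a≈b ] → a≉b a≈b }) refl
    go (suc j) = VecLex.next AddInfimumEq.⊥₋≈⊥₋ (go j)

  single-≤⁻ : ∀ {m} (j : Fin m) {a b} →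
              Poset._≤_ (labelPoset m) (single j a) (single j b) → a Λ.≤ b
  single-≤⁻ zero    (VecLex.this (AddInfimum.[ a≤b ] , _) _)  = a≤b
  single-≤⁻ zero    (VecLex.next AddInfimumEq.[ a≈b ] _)      = Λ.reflexive a≈b
  single-≤⁻ (suc j) (VecLex.this (_ , ⊥≉⊥) _)                 = contradiction AddInfimumEq.⊥₋≈⊥₋ ⊥≉⊥
  single-≤⁻ (suc j) (VecLex.next _ p)                         = single-≤⁻ j p

  single-<⁻ : ∀ {m} (j : Fin m) {a b} →
              Posetₚ._<_ (labelPoset m) (single j a) (single j b) → a Λₚ.< b
  single-<⁻ j (le , neq) = single-≤⁻ j le , neq ∘ single-cong j

module _ {P : Poset c ℓ₁ ℓ₂} where

  open Posetₚ P using (_<_; <-respˡ-≈)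

  linked-resp-head : ∀ {x x′ xs} → Poset._≈_ P x x′ → Linked _<_ (x ∷ xs) → Linked _<_ (x′ ∷ xs)
  linked-resp-head x≈x′ [-]        = [-]
  linked-resp-head x≈x′ (x<y ∷ ys) = <-respˡ-≈ x≈x′ x<y ∷ ys

-- Covers of multichains

module _ (P : Poset c ℓ₁ ℓ₂) {m : ℕ} where

  open Poset P hiding (refl)

  private
    Q = multichains P m
    module Q = Poset Q

    infixl 9 _!_
    _!_ : Multichain P m → Fin m → Carrier
    _!_ = _‼_ P

  ⋖-agree : Decidable _≈_ → ∀ {x w} (x⋖w : x ⋖[ Q ] w) {i j} →
            DifferAt P x w j → i ≢ j → x ! i ≈ w ! i
  ⋖-agree _≟_ x⋖w dⱼ i≢j = decidable-stable (_ ≟ _) λ dᵢ → i≢j (differUnique P x⋖w dᵢ dⱼ)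

  -- Off `j`, any `z` between `x` and `w` is squeezed between equal entries, so strictness on either
  -- side must show at `j`.
  ⋖-at : ∀ {x w} j → (∀ i → i ≢ j → x ! i ≈ w ! i) → (x ! j) ⋖[ P ] (w ! j) → x ⋖[ Q ] w
  ⋖-at {x} {w} j agree (covers (xⱼ≤wⱼ , xⱼ≉wⱼ) ∄z) =
    covers (pointwise x≤w , λ x≈w → xⱼ≉wⱼ (PW.lookup x≈w j)) between
    where
    x≤w : ∀ i → x ! i ≤ w ! i
    x≤w i with i Fin.≟ j
    ... | yes refl = xⱼ≤wⱼ
    ... | no  i≢j  = reflexive (agree i i≢j)
    between : ¬ (∃ λ z → Posetₚ._<_ Q x z × Posetₚ._<_ Q z w)
    between (z , (x≤z , x≉z) , (z≤w , z≉w)) =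
      ∄z (z ! j , (PW.lookup x≤z j , λ xⱼ≈zⱼ → x≉z (pointwise (x≈z xⱼ≈zⱼ)))
                , (PW.lookup z≤w j , λ zⱼ≈wⱼ → z≉w (pointwise (z≈w zⱼ≈wⱼ))))
      where
      x≈z : x ! j ≈ z ! j → ∀ i → x ! i ≈ z ! i
      x≈z e i with i Fin.≟ j
      ... | yes refl = e
      ... | no  i≢j  = antisym (PW.lookup x≤z i) (≤-respʳ-≈ (Eq.sym (agree i i≢j)) (PW.lookup z≤w i))
      z≈w : z ! j ≈ w ! j → ∀ i → z ! i ≈ w ! i
      z≈w e i with i Fin.≟ j
      ... | yes refl = e
      ... | no  i≢j  = antisym (PW.lookup z≤w i) (≤-respˡ-≈ (agree i i≢j) (PW.lookup x≤z i))

  raiseAt : ∀ (x : Multichain P m) j {q} → x ! j ≤ q → (∀ i → j Fin.< i → q ≤ x ! i) →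
            Multichain P m
  raiseAt (xs , l) j {q} xⱼ≤q q≤x = xs [ j ]≔ q , linked mono
    where
    mono : ∀ {i k} → i Fin.< k → lookup (xs [ j ]≔ q) i ≤ lookup (xs [ j ]≔ q) k
    mono {i} {k} i<k with i Fin.≟ j | k Fin.≟ j
    ... | yes refl | yes refl = contradiction i<k (Fin.<-irrefl refl)
    ... | yes refl | no k≢j
      rewrite lookup∘update j xs q | lookup∘update′ k≢j xs q = q≤x k i<k
    ... | no i≢j   | yes refl
      rewrite lookup∘update j xs q | lookup∘update′ i≢j xs q =
        trans (‼-mono P (xs , l) i<k) xⱼ≤q
    ... | no i≢j   | no k≢j
      rewrite lookup∘update′ i≢j xs q | lookup∘update′ k≢j xs q = ‼-mono P (xs , l) i<k

-- The product labeling

module _ (P : Poset c ℓ₁ ℓ₂) (fin : Finite P) (Λ : Poset c′ ℓ₁′ ℓ₂′)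
         (ƛ : EdgeLabeling P Λ) (m : ℕ) where

  open Poset P hiding (refl)

  private
    Q = multichains P m
    L = productLabels Λ m
    ƛᵐ = productLabeling P fin Λ ƛ m

    module Q = Poset Q
    module L = Poset L
    module Lₚ = Posetₚ L
    module Λₚ = Posetₚ Λ

    infixl 9 _!_
    _!_ : Multichain P m → Fin m → Carrier
    _!_ = _‼_ P

    _≟_ : Decidable _≈_
    _≟_ = ≈-dec P {m} fin

    label : ∀ {x y} → x ⋖[ P ] y → Poset.Carrier Λ
    label x⋖y = Func.to ƛ (_ , _ , x⋖y)

    labelᵐ : ∀ {x y} → x ⋖[ Q ] y → L.Carrier
    labelᵐ x⋖y = Func.to ƛᵐ (_ , _ , x⋖y)

    position : ∀ {x y} → x ⋖[ Q ] y → Fin m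
    position x⋖y = proj₁ (differIndex P fin x⋖y)

    differs : ∀ {x y} (x⋖y : x ⋖[ Q ] y) → DifferAt P x y (position x⋖y)
    differs x⋖y = proj₁ (proj₂ (differIndex P fin x⋖y))

  -- The index chosen by `differIndex` does not compute; as the differing index is unique, any `j`
  -- at hand may replace it.
  labelᵐ≈single : ∀ {x y} (x⋖y : x ⋖[ Q ] y) {j} (dⱼ : DifferAt P x y j) →
                  labelᵐ x⋖y L.≈ single Λ j (label (coverAt P x⋖y dⱼ))
  labelᵐ≈single x⋖y dⱼ =
    labelAt-cong P fin Λ ƛ m x⋖y x⋖y (PW.refl Eq.refl) (PW.refl Eq.refl) _ _ (differs x⋖y) dⱼ

  -- A later position would make the second label the smaller one. So along a rising chain positions
  -- never move back, and labels of `P` increase while the position stays.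
  labelᵐ-<⁻ : ∀ {x y x′ y′} (x⋖y : x ⋖[ Q ] y) (x′⋖y′ : x′ ⋖[ Q ] y′) {j}
              (dⱼ : DifferAt P x y j) → labelᵐ x⋖y Lₚ.< labelᵐ x′⋖y′ →
              position x′⋖y′ Fin.< j ⊎
              (Σ[ dⱼ′ ∈ DifferAt P x′ y′ j ]
                label (coverAt P x⋖y dⱼ) Λₚ.< label (coverAt P x′⋖y′ dⱼ′))
  labelᵐ-<⁻ x⋖y x′⋖y′ {j} dⱼ lt with Fin.<-cmp (position x′⋖y′) j
  ... | tri< k<j _ _ = inj₁ k<j
  ... | tri≈ _ refl _ = inj₂ (differs x′⋖y′ , single-<⁻ Λ j (Lₚ.<-respˡ-≈ (labelᵐ≈single x⋖y dⱼ) lt))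
  ... | tri> _ _ j<k =
    contradiction (Lₚ.<-respˡ-≈ (labelᵐ≈single x⋖y dⱼ) lt) (Lₚ.<-asym (single-<-later Λ _ _ j<k))

  -- Positions only decrease from `j` on, so no later coordinate is ever touched.
  rising⇒agreeAbove : ∀ {x w y} (x⋖w : x ⋖[ Q ] w) (C : MaximalChain Q w y) →
                      Rising Q L ƛᵐ (step x⋖w C) → ∀ {i j} → DifferAt P x w j →
                      j Fin.< i → x ! i ≈ y ! i
  rising⇒agreeAbove x⋖w C C↑ dⱼ j<i with ⋖-agree P _≟_ x⋖w dⱼ (Fin.<⇒≢ j<i ∘ ≡.sym)
  rising⇒agreeAbove x⋖w (stop w≈y) _ {i} dⱼ j<i | xᵢ≈wᵢ = Eq.trans xᵢ≈wᵢ (PW.lookup w≈y i)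
  rising⇒agreeAbove x⋖w (step w⋖v C) (lt ∷ C↑) dⱼ j<i | xᵢ≈wᵢ with labelᵐ-<⁻ x⋖w w⋖v dⱼ lt
  ... | inj₁ k<j       =
    Eq.trans xᵢ≈wᵢ (rising⇒agreeAbove w⋖v C C↑ (differs w⋖v) (Fin.<-trans k<j j<i))
  ... | inj₂ (dⱼ′ , _) = Eq.trans xᵢ≈wᵢ (rising⇒agreeAbove w⋖v C C↑ dⱼ′ j<i)

  -- The steps at `j` form an initial block of the chain. Once it moves to an earlier coordinate,
  -- entry `j` is final and `E` stops.
  rising⇒coordinateRising : ∀ {x w y} (x⋖w : x ⋖[ Q ] w) (C : MaximalChain Q w y) →
                            Rising Q L ƛᵐ (step x⋖w C) → ∀ {j} (dⱼ : DifferAt P x w j) →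
                            Σ[ E ∈ MaximalChain P (w ! j) (y ! j) ]
                              Rising P Λ ƛ (step (coverAt P x⋖w dⱼ) E)
  rising⇒coordinateRising x⋖w (stop w≈y) _ {j} dⱼ = stop (PW.lookup w≈y j) , [-]
  rising⇒coordinateRising x⋖w (step w⋖v C) (lt ∷ C↑) {j} dⱼ with labelᵐ-<⁻ x⋖w w⋖v dⱼ lt
  ... | inj₁ k<j = stop (rising⇒agreeAbove w⋖v C C↑ (differs w⋖v) k<j) , [-]
  ... | inj₂ (dⱼ′ , lt′) =
    let E , E↑ = rising⇒coordinateRising w⋖v C C↑ dⱼ′
    in step (coverAt P w⋖v dⱼ′) E , lt′ ∷ E↑

  multichains-firstStep : FirstStep P Λ ƛ → FirstStep Q L ƛᵐ
  multichains-firstStep firstStep {x} {z = w} {w′} x⋖w C C↑ x⋖w′ w′≤y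
    with Fin.<-cmp (position x⋖w′) (position x⋖w)
  ... | tri< k<j _ _ = inj₂ (single-<-later Λ _ _ k<j)
  -- The rising chain leaves coordinate `k` unchanged up to `y`, whereas `w′ ≤ y` raises it.
  ... | tri> _ _ j<k =
    contradiction (rising⇒agreeAbove x⋖w C C↑ (differs x⋖w) j<k)
      (⋖∧≤⇒≉ P (coverAt P x⋖w′ (differs x⋖w′)) (PW.lookup w′≤y _))
  ... | tri≈ _ k≡j _ = sameCoordinate (≡.subst (DifferAt P x w′) k≡j (differs x⋖w′))
    where
    j = position x⋖w
    dⱼ = differs x⋖w
    sameCoordinate : DifferAt P x w′ j → w Q.≈ w′ ⊎ labelᵐ x⋖w Lₚ.< labelᵐ x⋖w′
    sameCoordinate dⱼ′ with rising⇒coordinateRising x⋖w C C↑ dⱼ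
    ... | E , E↑ with firstStep (coverAt P x⋖w dⱼ) E E↑ (coverAt P x⋖w′ dⱼ′) (PW.lookup w′≤y j)
    ... | inj₂ lt = inj₂ (Lₚ.<-respʳ-≈ (L.Eq.sym {labelᵐ x⋖w′} (labelᵐ≈single x⋖w′ dⱼ′)) (single-<-mono Λ j lt))
    ... | inj₁ wⱼ≈w′ⱼ = inj₁ (pointwise w≈w′)
      where
      w≈w′ : ∀ i → w ! i ≈ w′ ! i
      w≈w′ i with i Fin.≟ j
      ... | yes refl = wⱼ≈w′ⱼ
      ... | no  i≢j  = Eq.trans (Eq.sym (⋖-agree P _≟_ x⋖w dⱼ i≢j)) (⋖-agree P _≟_ x⋖w′ dⱼ′ i≢j)

  -- The last clause says that C raises only coordinates below n, in the form
  -- that allows prepending further steps.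
  RisingBelow : ℕ → Multichain P m → Multichain P m → Set _
  RisingBelow n x y = Σ[ C ∈ MaximalChain Q x y ] Rising Q L ƛᵐ C ×
    (∀ i a → n ℕ.≤ toℕ i → Linked Lₚ._<_ (single Λ i a ∷ labels Q L ƛᵐ C))

  -- Follows `E` at coordinate `j`, then hands over to `continue` for the earlier ones. The second
  -- component makes the junction of two consecutive steps at `j` rising.
  raiseCoordinate : ∀ {y} j →
    (∀ x → x Q.≤ y → (∀ i → j Fin.≤ i → x ! i ≈ y ! i) → RisingBelow (toℕ j) x y) →
    ∀ {p} x → x Q.≤ y → (∀ i → j Fin.< i → x ! i ≈ y ! i) → x ! j ≈ p →
    (E : MaximalChain P p (y ! j)) → Rising P Λ ƛ E →
    Σ[ (C , _) ∈ RisingBelow (suc (toℕ j)) x y ]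
      (∀ a → Linked Λₚ._<_ (a ∷ labels P Λ ƛ E) → Linked Lₚ._<_ (single Λ j a ∷ labels Q L ƛᵐ C))
  raiseCoordinate {y} j continue x x≤y agree xⱼ≈p (stop p≈yⱼ) _ =
    let C , C↑ , below = continue x x≤y agree′
    -- The clause from `continue` includes index `j` itself, which gives the junction from the last
    -- step at `j` to an earlier coordinate.
    in (C , C↑ , λ i a j<i → below i a (ℕ.<⇒≤ j<i)) , λ a _ → below j a ℕ.≤-refl
    where
    agree′ : ∀ i → j Fin.≤ i → x ! i ≈ y ! i
    agree′ i j≤i with i Fin.≟ j
    ... | yes refl = Eq.trans xⱼ≈p p≈yⱼ
    ... | no  i≢j  = agree i (Fin.≤∧≢⇒< j≤i (i≢j ∘ ≡.sym))
  raiseCoordinate {y} j continue x x≤y agree xⱼ≈p (step {z = q} p⋖q E) E↑ =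
    let (C , C↑ , below) , at = raiseCoordinate j continue w w≤y agree′ wⱼ≈q E (tail E↑)
        C⁺↑ = linked-resp-head {P = L} label≈ (at _ E↑)
    in ( step x⋖w C
       , C⁺↑
       , λ i a j<i → Lₚ.<-respʳ-≈ label≈ (single-<-later Λ _ _ j<i) ∷ C⁺↑)
     , λ { a (a< ∷ _) → Lₚ.<-respʳ-≈ label≈ (single-<-mono Λ j a<) ∷ C⁺↑ }
    where
    xⱼ≤q : x ! j ≤ q
    xⱼ≤q = ≤-respˡ-≈ (Eq.sym xⱼ≈p) (proj₁ (Covers.less p⋖q))
    q≤yⱼ : q ≤ y ! j
    q≤yⱼ = chain⇒≤ P E
    w : Multichain P m
    -- Later coordinates already have their final values, so `q ≤ yⱼ ≤ yᵢ ≈ xᵢ` and the raised tuple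
    -- is still a multichain.
    w = raiseAt P x j xⱼ≤q λ i j<i →
          ≤-respʳ-≈ (Eq.sym (agree i j<i)) (trans q≤yⱼ (‼-mono P y j<i))
    wⱼ≈q : w ! j ≈ q
    wⱼ≈q = Eq.reflexive (lookup∘update j (proj₁ x) q)
    x≈w : ∀ i → i ≢ j → x ! i ≈ w ! i
    x≈w i i≢j = Eq.reflexive (≡.sym (lookup∘update′ i≢j (proj₁ x) q))
    w≤y : w Q.≤ y
    w≤y = pointwise λ i → go i (i Fin.≟ j)
      where
      go : ∀ i → Dec (i ≡ j) → w ! i ≤ y ! i
      go i (yes refl) = ≤-respˡ-≈ (Eq.sym wⱼ≈q) q≤yⱼ
      go i (no  i≢j)  = ≤-respˡ-≈ (x≈w i i≢j) (PW.lookup x≤y i)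
    agree′ : ∀ i → j Fin.< i → w ! i ≈ y ! i
    agree′ i j<i = Eq.trans (Eq.sym (x≈w i λ { refl → Fin.<-irrefl refl j<i })) (agree i j<i)
    xⱼ⋖wⱼ : (x ! j) ⋖[ P ] (w ! j)
    xⱼ⋖wⱼ = Covers-resp-≈ P (Eq.sym xⱼ≈p) (Eq.sym wⱼ≈q) p⋖q
    x⋖w : x ⋖[ Q ] w
    x⋖w = ⋖-at P {x = x} {w = w} j x≈w xⱼ⋖wⱼ
    label≈ : single Λ j (label p⋖q) L.≈ labelᵐ x⋖w
    label≈ = L.Eq.sym {labelᵐ x⋖w} (L.Eq.trans {labelᵐ x⋖w}
      (labelᵐ≈single x⋖w (proj₂ (Covers.less xⱼ⋖wⱼ)))
      (single-cong Λ j (Func.cong ƛ (xⱼ≈p , wⱼ≈q))))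

  module _ (exists : ∀ {x y} → x ≤ y → ∃ λ (C : MaximalChain P x y) → Rising P Λ ƛ C) where

    -- Induction on the number `n` of leading coordinates that may still differ; the last of these
    -- is raised first.
    risingBelow : ∀ n → n ℕ.≤ m → ∀ {y} x → x Q.≤ y →
                  (∀ i → n ℕ.≤ toℕ i → x ! i ≈ y ! i) → RisingBelow n x y
    risingBelow zero    _   x x≤y agree =
      stop (pointwise λ i → agree i ℕ.z≤n) , [] , λ _ _ _ → [-]
    risingBelow (suc n) n<m {y} x x≤y agree =
      ≡.subst (λ k → RisingBelow (suc k) x y) j≡n
        (proj₁ (raiseCoordinate j continue x x≤y agree′ Eq.refl (proj₁ E) (proj₂ E)))
      where
      j = fromℕ< n<m
      j≡n : toℕ j ≡ n
      j≡n = Fin.toℕ-fromℕ< n<m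
      E = exists (PW.lookup x≤y j)
      agree′ : ∀ i → j Fin.< i → x ! i ≈ y ! i
      agree′ i j<i = agree i (≡.subst (ℕ._< toℕ i) j≡n j<i)
      continue : ∀ x → x Q.≤ y → (∀ i → j Fin.≤ i → x ! i ≈ y ! i) → RisingBelow (toℕ j) x y
      continue x x≤y agree = ≡.subst (λ k → RisingBelow k x y) (≡.sym j≡n)
        (risingBelow n (ℕ.<⇒≤ n<m) x x≤y λ i n≤i → agree i (≡.subst (ℕ._≤ toℕ i) (≡.sym j≡n) n≤i))

    multichains-rising : ∀ {x y} → x Q.≤ y → ∃ λ (C : MaximalChain Q x y) → Rising Q L ƛᵐ C
    multichains-rising {x} x≤y =
      -- With `n = m` the agreement condition is vacuous.
      let C , C↑ , _ = risingBelow m ℕ.≤-refl x x≤y λ i m≤i →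
                         contradiction (Fin.toℕ<n i) (ℕ.≤⇒≯ m≤i)
      in C , C↑

theorem3p4 : ∀ {c ℓ₁ ℓ₂ c′ ℓ₁′ ℓ₂′ : Level}
    (P : Poset c ℓ₁ ℓ₂) (fin : Finite P)
    (Λ : Poset c′ ℓ₁′ ℓ₂′) (ƛ : EdgeLabeling P Λ) →
    IsELLabeling P Λ ƛ →
    ∀ (m : ℕ) .{{_ : NonZero m}} →
    IsELLabeling (multichains P m) (productLabels Λ m) (productLabeling P fin Λ ƛ m)
theorem3p4 P fin Λ ƛ el m =
  FirstStep⇒EL (multichains P m) (productLabels Λ m) (productLabeling P fin Λ ƛ m)
    (multichains-firstStep P fin Λ ƛ m (EL⇒FirstStep P Λ ƛ (≈-dec P {m} fin) el))
    (multichains-bounded P fin m (IsELLabeling.bounded el))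
    (multichains-rising P fin Λ ƛ m λ x≤y →
      let (C , C↑ , _) , _ = IsELLabeling.rising el x≤y in C , C↑)
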